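{- $VW^*_{Rel}\le_I VW_0$; that is, the first-order theory $VW^*_{Rel}$ is interpretable in the first-order theory $VW_0$ (both defined in the context).
   Context: $T\le_I S$ means that $T$ is (relatively) formally interpretable in $S$ in the usual sense. Both theories include the usual axioms for identity. Strings: $\Sigma^*$ is the set of finite words over $\{1,2\}$, including the empty word $e$; $^\frown$ is concatenation; $s\sqsubseteq t$ between strings means $s$ is an initial segment of $t$, and $s\sqsupseteq t$ means $s$ is an end segment of $t$ (both possibly improper). $D=\{1,2\}$. The same symbols are used for binary relation symbols. Both vocabularies contain a constant $\underline{s}$ for each $s\in\Sigma^*$. $VW^*_{Rel}$: vocabulary: the constants $\underline{s}$, binary relation symbols $A^{\wedge}_1,A^{\wedge}_2,A^{\vee}_1,A^{\vee}_2$ (expressing the graphs of $x\mapsto x^\frown1$, $x\mapsto x^\frown2$, $x\mapsto1^\frown x$, $x\mapsto2^\frown x$), and binary relation symbols $\sqsubseteq,\sqsupseteq$. Axioms (for all $s,t\in\Sigma^*$, $d\in D$): (1) $\neg(\underline{s}=\underline{t})$ for distinct $s,t$; (2) $A^{\wedge}_d(\underline{s},\underline{s^\frown d})$; (3) $A^{\vee}_d(\underline{s},\underline{d^\frown s})$; (4) $\forall y\big(A^{\wedge}_d(\underline{t},y)\to\forall z(z\sqsubseteq y\leftrightarrow z\sqsubseteq\underline{t}\vee z=y)\big)$; (5) $\forall y\big(A^{\vee}_d(\underline{t},y)\to\forall z(z\sqsupseteq y\leftrightarrow z\sqsupseteq\underline{t}\vee z=y)\big)$; (6) $\forall x\exists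 y\,A^{\wedge}_d(x,y)$; (7) $\forall x\exists y\,A^{\vee}_d(x,y)$; (8) $\forall x,y,z(A^{\wedge}_d(x,y)\ \&\ A^{\wedge}_d(x,z)\to y=z)$; (9) $\forall x,y,z(A^{\vee}_d(x,y)\ \&\ A^{\vee}_d(x,z)\to y=z)$; together with $\underline{e}\sqsubseteq\underline{t}$; $\forall x(x\sqsubseteq\underline{e}\to x=\underline{e})$; $\underline{e}\sqsupseteq\underline{t}$; $\forall x(x\sqsupseteq\underline{e}\to x=\underline{e})$; and $\forall x,y(x\sqsubseteq y\ \&\ y\sqsubseteq x\to x=y)$. $VW_0$: vocabulary: the constants $\underline{s}$ and the binary relation symbols $\sqsubseteq,\sqsupseteq$. Write $x\sqsubset y$ for $x\sqsubseteq y\ \&\ x\ne y$ and $x\sqsupset y$ for $x\sqsupseteq y\ \&\ x\ne y$. Axioms: ($VW_0$1) $\neg\,\underline{s}=\underline{t}$ for distinct $s,t\in\Sigma^*$; ($VW_0$2) $\forall x(x\sqsubseteq\underline{t}\leftrightarrow\bigvee_{s\sqsubseteq t}x=\underline{s})$ for $t\in\Sigma^*$; ($VW_0$3) $\forall x(x\sqsupseteq\underline{t}\leftrightarrow\bigvee_{s\sqsupseteq t}x=\underline{s})$ for $t\in\Sigma^*$; ($VW_0$4) $\forall x\big(\forall y(y\sqsubset x\leftrightarrow y\sqsubset\underline{t})\to\bigwedge_{d\in D}(\underline{d}\sqsupseteq x\ \&\ \underline{d}\sqsupseteq\underline{t}\to x=\underline{t})\big)$ for $t\in\Sigma^*$;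 ($VW_0$5) $\forall x\big(\forall y(y\sqsupset x\leftrightarrow y\sqsupset\underline{t})\to\bigwedge_{d\in D}(\underline{d}\sqsubseteq x\ \&\ \underline{d}\sqsubseteq\underline{t}\to x=\underline{t})\big)$ for $t\in\Sigma^*$; (VW10) $\forall x,y(x\sqsubseteq y\ \&\ y\sqsubseteq x\to x=y)$. -}

module Defs where

open import Data.Fin.Base using (Fin; zero; suc; _↑ˡ_; _↑ʳ_)
open import Data.List.Base using (List; []; _∷_; _∷ʳ_; [_]; map; foldr; inits; tails)
open import Data.List.Membership.Propositional using (_∈_)
open import Data.Nat.Base using (ℕ; zero; suc; _+_)
open import Data.Product.Base using (Σ-syntax)
open import Data.Vec.Base using (Vec; []; _∷_)
import Data.Vec.Base as Vec
open import Function.Base using (_∘_)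
open import Level using (0ℓ)
open import Relation.Binary.PropositionalEquality.Core using (_≢_)
open import Relation.Unary using (Pred)

------------------------------------------------------------------------
-- First-order logic with identity

-- Vocabularies of constants and relation symbols.  Identity is a logical
-- symbol, hence not listed in the vocabulary.
record Signature : Set₁ where
  field
    Const : Set
    Rel   : Set
    arity : Rel → ℕ

open Signature public

-- Well-scoped de Bruijn syntax: n bounds the free variables, and under a
-- quantifier zero is the variable it binds.
data Term (L : Signature) (n : ℕ) : Set where
  var   : Fin n → Term L n
  const : Const L → Term L n

infix  7 _≐_
infixr 5 _∧̇_
infixr 4 _∨̇_
infixr 3 _⇒̇_

data Formula (L : Signature) (n : ℕ) : Set where
  rel  : (R : Rel L) → Vec (Term L n) (arity L R) → Formula L n
  _≐_  : Term L n → Term L n → Formula L n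
  ⊥̇    : Formula L n
  _∧̇_  : Formula L n → Formula L n → Formula L n
  _∨̇_  : Formula L n → Formula L n → Formula L n
  _⇒̇_  : Formula L n → Formula L n → Formula L n
  ∀̇    : Formula L (suc n) → Formula L n
  ∃̇    : Formula L (suc n) → Formula L n

Sentence : Signature → Set
Sentence L = Formula L 0

-- A theory is given by its set of nonlogical axioms.
Theory : Signature → Set₁
Theory L = Pred (Sentence L) 0ℓ

module _ {L : Signature} where

  infix 6 ¬̇_
  infix 2 _⇔̇_

  ¬̇_ : ∀ {n} → Formula L n → Formula L n
  ¬̇ φ = φ ⇒̇ ⊥̇

  _⇔̇_ : ∀ {n} → Formula L n → Formula L n → Formula L n
  φ ⇔̇ ψ = (φ ⇒̇ ψ) ∧̇ (ψ ⇒̇ φ)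

  ⋁̇ : ∀ {n} → List (Formula L n) → Formula L n
  ⋁̇ = foldr _∨̇_ ⊥̇

  substTerm : ∀ {m n} → (Fin m → Term L n) → Term L m → Term L n
  substTerm σ (var i)   = σ i
  substTerm σ (const c) = const c

  lift : ∀ {m n} → (Fin m → Term L n) → Fin (suc m) → Term L (suc n)
  lift σ zero    = var zero
  lift σ (suc i) = substTerm (var ∘ suc) (σ i)

  subst : ∀ {m n} → (Fin m → Term L n) → Formula L m → Formula L n
  subst σ (rel R ts) = rel R (Vec.map (substTerm σ) ts)
  subst σ (s ≐ t)    = substTerm σ s ≐ substTerm σ t
  subst σ ⊥̇          = ⊥̇
  subst σ (φ ∧̇ ψ)    = subst σ φ ∧̇ subst σ ψ
  subst σ (φ ∨̇ ψ)    = subst σ φ ∨̇ subst σ ψ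
  subst σ (φ ⇒̇ ψ)    = subst σ φ ⇒̇ subst σ ψ
  subst σ (∀̇ φ)      = ∀̇ (subst (lift σ) φ)
  subst σ (∃̇ φ)      = ∃̇ (subst (lift σ) φ)

  rename : ∀ {m n} → (Fin m → Fin n) → Formula L m → Formula L n
  rename ρ = subst (var ∘ ρ)

  weaken : ∀ {n} → Formula L n → Formula L (suc n)
  weaken = rename suc

  single : ∀ {n} → Term L n → Fin (suc n) → Term L n
  single t zero    = t
  single t (suc i) = var i

  infix 8 _[_/0]

  _[_/0] : ∀ {n} → Formula L (suc n) → Term L n → Formula L n
  φ [ t /0] = subst (single t) φ

  ∃!̇ : ∀ {n} → Formula L (suc n) → Formula L n
  ∃!̇ φ = ∃̇ (φ ∧̇ ∀̇ (subst (lift (var ∘ suc)) φ ⇒̇ var zero ≐ var (suc zero)))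

-- Classical natural deduction from the axioms of T.  The rule `inhabited`
-- is the usual convention that universes of discourse are nonempty; it is
-- derivable as soon as there is a constant.
infix 1 _⨾_⊢_

data _⨾_⊢_ {L : Signature} (T : Theory L) :
           ∀ {n} → List (Formula L n) → Formula L n → Set where
  axiom : ∀ {n} {Γ : List (Formula L n)} {φ} →
          T φ → T ⨾ Γ ⊢ rename (λ ()) φ
  hyp   : ∀ {n} {Γ : List (Formula L n)} {φ} →
          φ ∈ Γ → T ⨾ Γ ⊢ φ
  raa   : ∀ {n} {Γ : List (Formula L n)} {φ} →
          T ⨾ ¬̇ φ ∷ Γ ⊢ ⊥̇ → T ⨾ Γ ⊢ φ
  ∧-I   : ∀ {n} {Γ : List (Formula L n)} {φ ψ} →
          T ⨾ Γ ⊢ φ → T ⨾ Γ ⊢ ψ → T ⨾ Γ ⊢ φ ∧̇ ψ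
  ∧-E₁  : ∀ {n} {Γ : List (Formula L n)} {φ ψ} →
          T ⨾ Γ ⊢ φ ∧̇ ψ → T ⨾ Γ ⊢ φ
  ∧-E₂  : ∀ {n} {Γ : List (Formula L n)} {φ ψ} →
          T ⨾ Γ ⊢ φ ∧̇ ψ → T ⨾ Γ ⊢ ψ
  ∨-I₁  : ∀ {n} {Γ : List (Formula L n)} {φ ψ} →
          T ⨾ Γ ⊢ φ → T ⨾ Γ ⊢ φ ∨̇ ψ
  ∨-I₂  : ∀ {n} {Γ : List (Formula L n)} {φ ψ} →
          T ⨾ Γ ⊢ ψ → T ⨾ Γ ⊢ φ ∨̇ ψ
  ∨-E   : ∀ {n} {Γ : List (Formula L n)} {φ ψ χ} →
          T ⨾ Γ ⊢ φ ∨̇ ψ → T ⨾ φ ∷ Γ ⊢ χ → T ⨾ ψ ∷ Γ ⊢ χ → T ⨾ Γ ⊢ χ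
  ⇒-I   : ∀ {n} {Γ : List (Formula L n)} {φ ψ} →
          T ⨾ φ ∷ Γ ⊢ ψ → T ⨾ Γ ⊢ φ ⇒̇ ψ
  ⇒-E   : ∀ {n} {Γ : List (Formula L n)} {φ ψ} →
          T ⨾ Γ ⊢ φ ⇒̇ ψ → T ⨾ Γ ⊢ φ → T ⨾ Γ ⊢ ψ
  ∀-I   : ∀ {n} {Γ : List (Formula L n)} {φ} →
          T ⨾ map weaken Γ ⊢ φ → T ⨾ Γ ⊢ ∀̇ φ
  ∀-E   : ∀ {n} {Γ : List (Formula L n)} {φ} →
          T ⨾ Γ ⊢ ∀̇ φ → (t : Term L n) → T ⨾ Γ ⊢ φ [ t /0]
  ∃-I   : ∀ {n} {Γ : List (Formula L n)} {φ} →
          (t : Term L n) → T ⨾ Γ ⊢ φ [ t /0] → T ⨾ Γ ⊢ ∃̇ φ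
  ∃-E   : ∀ {n} {Γ : List (Formula L n)} {φ χ} →
          T ⨾ Γ ⊢ ∃̇ φ → T ⨾ φ ∷ map weaken Γ ⊢ weaken χ → T ⨾ Γ ⊢ χ
  ≐-I   : ∀ {n} {Γ : List (Formula L n)} {t} →
          T ⨾ Γ ⊢ t ≐ t
  ≐-E   : ∀ {n} {Γ : List (Formula L n)} {s t} (φ : Formula L (suc n)) →
          T ⨾ Γ ⊢ s ≐ t → T ⨾ Γ ⊢ φ [ s /0] → T ⨾ Γ ⊢ φ [ t /0]
  inhabited : ∀ {n} {Γ : List (Formula L n)} →
          T ⨾ Γ ⊢ ∃̇ (var zero ≐ var zero)

infix 1 _⊢_

_⊢_ : {L : Signature} → Theory L → Sentence L → Set
T ⊢ φ = T ⨾ [] ⊢ φ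

------------------------------------------------------------------------
-- Relative interpretations

-- A one-dimensional, parameter-free translation with a domain formula and
-- absolute identity.  A constant c is interpreted by a formula saying
-- "variable 0 is the value of c"; a k-ary relation symbol by a formula in
-- which variable i is the i-th argument.
record Translation (L M : Signature) : Set where
  field
    domain : Formula M 1
    constF : Const L → Formula M 1
    relF   : (R : Rel L) → Formula M (arity L R)

module _ {L M : Signature} (τ : Translation L M) where
  open Translation τ

  at0 : ∀ {n} → Formula M 1 → Formula M (suc n)
  at0 = rename (λ _ → zero)

  -- "φ holds of the value of t at variable 0".
  atValue : ∀ {n} → Term L n → Formula M (suc n) → Formula M n
  atValue (var i)   φ = φ [ var i /0]
  atValue (const c) φ = ∃̇ (at0 domain ∧̇ at0 (constF c) ∧̇ φ)

  -- Variables 0, …, k-1 of the formula are argument places, filled by the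
  -- entries of the vector in this order.
  atValues : ∀ {k n} → Vec (Term L n) k → Formula M (k + n) → Formula M n
  atValues                 []       φ = φ
  atValues {suc k} {n} (t ∷ ts) φ =
    atValues ts (atValue (substTerm (var ∘ (k ↑ʳ_)) t) φ)

  translate : ∀ {n} → Formula L n → Formula M n
  translate {n} (rel R ts) = atValues ts (rename (_↑ˡ n) (relF R))
  translate (s ≐ t)   = atValues (s ∷ t ∷ []) (var zero ≐ var (suc zero))
  translate ⊥̇         = ⊥̇
  translate (φ ∧̇ ψ)   = translate φ ∧̇ translate ψ
  translate (φ ∨̇ ψ)   = translate φ ∨̇ translate ψ
  translate (φ ⇒̇ ψ)   = translate φ ⇒̇ translate ψ
  translate (∀̇ φ)     = ∀̇ (at0 domain ⇒̇ translate φ)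
  translate (∃̇ φ)     = ∃̇ (at0 domain ∧̇ translate φ)

record IsInterpretation {L M : Signature} (T : Theory L) (S : Theory M)
                        (τ : Translation L M) : Set where
  open Translation τ
  field
    domain-nonempty : S ⊢ ∃̇ domain
    const-defined   : ∀ c → S ⊢ ∃!̇ (domain ∧̇ constF c)
    axioms          : ∀ {φ} → T φ → S ⊢ translate τ φ

infix 4 _≤I_

-- T is relatively interpretable in S.
_≤I_ : {L M : Signature} → Theory L → Theory M → Set
_≤I_ {L} {M} T S = Σ[ τ ∈ Translation L M ] IsInterpretation T S τ

------------------------------------------------------------------------
-- Strings

data D : Set where
  𝟏 𝟐 : D

Σ* : Set
Σ* = List D

⋀D : ∀ {L n} → (D → Formula L n) → Formula L n
⋀D φ = φ 𝟏 ∧̇ φ 𝟐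

-- ⋁_{s ⊑ t} φ s and ⋁_{s ⊒ t} φ s: `inits t` lists the initial segments of
-- t and `tails t` its end segments, t itself included in both.
⋁⊑ ⋁⊒ : ∀ {L n} → Σ* → (Σ* → Formula L n) → Formula L n
⋁⊑ t φ = ⋁̇ (map φ (inits t))
⋁⊒ t φ = ⋁̇ (map φ (tails t))

-- Variables 0, 1, 2, innermost first.
v0 : ∀ {L n} → Term L (1 + n)
v0 = var zero

v1 : ∀ {L n} → Term L (2 + n)
v1 = var (suc zero)

v2 : ∀ {L n} → Term L (3 + n)
v2 = var (suc (suc zero))

------------------------------------------------------------------------
-- The theory VW*Rel

module Rel* where

  data Symbol : Set where
    A^ Aᵛ  : D → Symbol
    init end : Symbol

  signature : Signature
  signature = record { Const = Σ* ; Rel = Symbol ; arity = λ _ → 2 }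

  module _ {n : ℕ} where

    infix 7 _⊑_ _⊒_

    -- ⟪ d ⟫^ x y : y is x followed by d;  ⟪ d ⟫ᵛ x y : y is d followed by x.
    ⟪_⟫^ ⟪_⟫ᵛ : D → Term signature n → Term signature n → Formula signature n
    ⟪ d ⟫^ x y = rel (A^ d) (x ∷ y ∷ [])
    ⟪ d ⟫ᵛ x y = rel (Aᵛ d) (x ∷ y ∷ [])

    _⊑_ _⊒_ : Term signature n → Term signature n → Formula signature n
    x ⊑ y = rel init (x ∷ y ∷ [])
    x ⊒ y = rel end (x ∷ y ∷ [])

  data Axiom : Theory signature where
    distinct : ∀ {s t} → s ≢ t →
               Axiom (¬̇ (const s ≐ const t))
    A^-const : ∀ d s → Axiom (⟪ d ⟫^ (const s) (const (s ∷ʳ d)))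
    Aᵛ-const : ∀ d s → Axiom (⟪ d ⟫ᵛ (const s) (const (d ∷ s)))
    A^-⊑     : ∀ d t →
               Axiom (∀̇ (⟪ d ⟫^ (const t) v0 ⇒̇
                         ∀̇ (v0 ⊑ v1 ⇔̇ v0 ⊑ const t ∨̇ v0 ≐ v1)))
    Aᵛ-⊒     : ∀ d t →
               Axiom (∀̇ (⟪ d ⟫ᵛ (const t) v0 ⇒̇
                         ∀̇ (v0 ⊒ v1 ⇔̇ v0 ⊒ const t ∨̇ v0 ≐ v1)))
    A^-total : ∀ d → Axiom (∀̇ (∃̇ (⟪ d ⟫^ v1 v0)))
    Aᵛ-total : ∀ d → Axiom (∀̇ (∃̇ (⟪ d ⟫ᵛ v1 v0)))
    A^-func  : ∀ d →
               Axiom (∀̇ (∀̇ (∀̇ (⟪ d ⟫^ v2 v1 ∧̇ ⟪ d ⟫^ v2 v0 ⇒̇ v1 ≐ v0))))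
    Aᵛ-func  : ∀ d →
               Axiom (∀̇ (∀̇ (∀̇ (⟪ d ⟫ᵛ v2 v1 ∧̇ ⟪ d ⟫ᵛ v2 v0 ⇒̇ v1 ≐ v0))))
    e-⊑      : ∀ t → Axiom (const [] ⊑ const t)
    ⊑-e      : Axiom (∀̇ (v0 ⊑ const [] ⇒̇ v0 ≐ const []))
    e-⊒      : ∀ t → Axiom (const [] ⊒ const t)
    ⊒-e      : Axiom (∀̇ (v0 ⊒ const [] ⇒̇ v0 ≐ const []))
    ⊑-antisym : Axiom (∀̇ (∀̇ (v1 ⊑ v0 ∧̇ v0 ⊑ v1 ⇒̇ v1 ≐ v0)))

VW*Rel : Theory Rel*.signature
VW*Rel = Rel*.Axiom

------------------------------------------------------------------------
-- The theory VW₀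

module Rel₀ where

  data Symbol : Set where
    init end : Symbol

  signature : Signature
  signature = record { Const = Σ* ; Rel = Symbol ; arity = λ _ → 2 }

  module _ {n : ℕ} where

    infix 7 _⊑_ _⊒_ _⊏_ _⊐_

    _⊑_ _⊒_ _⊏_ _⊐_ : Term signature n → Term signature n →
                      Formula signature n
    x ⊑ y = rel init (x ∷ y ∷ [])
    x ⊒ y = rel end (x ∷ y ∷ [])
    x ⊏ y = x ⊑ y ∧̇ ¬̇ (x ≐ y)
    x ⊐ y = x ⊒ y ∧̇ ¬̇ (x ≐ y)

  data Axiom : Theory signature where
    distinct : ∀ {s t} → s ≢ t →
               Axiom (¬̇ (const s ≐ const t))
    ⊑-const  : ∀ t →
               Axiom (∀̇ (v0 ⊑ const t ⇔̇ ⋁⊑ t (λ s → v0 ≐ const s)))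
    ⊒-const  : ∀ t →
               Axiom (∀̇ (v0 ⊒ const t ⇔̇ ⋁⊒ t (λ s → v0 ≐ const s)))
    ⊏-determines : ∀ t →
               Axiom (∀̇ (∀̇ (v0 ⊏ v1 ⇔̇ v0 ⊏ const t) ⇒̇
                         ⋀D (λ d → const [ d ] ⊒ v0 ∧̇ const [ d ] ⊒ const t
                                   ⇒̇ v0 ≐ const t)))
    ⊐-determines : ∀ t →
               Axiom (∀̇ (∀̇ (v0 ⊐ v1 ⇔̇ v0 ⊐ const t) ⇒̇
                         ⋀D (λ d → const [ d ] ⊑ v0 ∧̇ const [ d ] ⊑ const t
                                   ⇒̇ v0 ≐ const t)))
    ⊑-antisym : Axiom (∀̇ (∀̇ (v1 ⊑ v0 ∧̇ v0 ⊑ v1 ⇒̇ v1 ≐ v0)))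

VW₀ : Theory Rel₀.signature
VW₀ = Rel₀.Axiom

{-# OPTIONS --safe #-}

-- Keep the universe, the constants and both segment relations, and let A^ d x y
-- say that y is the only element with d ⊒ y whose proper initial segments are
-- exactly the initial segments of x, or else that y = x and there is no such
-- element.  This is provably the graph of a total function.  At x = s the
-- segment axioms show that s⌢d is such an element, and (VW₀4) for t = s⌢d makes
-- it the only one.  Exchanging ⊑ and ⊒, with (VW₀5), gives Aᵛ.  The remaining
-- axioms concern the segments of constants only, or are axioms of VW₀.
module Submission where

open import Defs

open import Data.Fin.Base using (Fin; zero; suc; _↑ˡ_; _↑ʳ_)
open import Data.List.Base
  using (List; []; _∷_; _∷ʳ_; [_]; map; inits; tails; length)
open import Data.List.Membership.Propositional using (_∈_; _∉_)
open import Data.List.Membership.Propositional.Properties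
  using (∈-map⁻; ∈-++⁺ˡ; ∈-++⁺ʳ; ∈-++⁻)
open import Data.List.Properties using (map-++; length-++-sucʳ; ++-identityʳ)
open import Data.List.Relation.Unary.Any using (here; there)
open import Data.Nat.Base using (ℕ; suc; _+_; _≤_; z≤n; s≤s)
open import Data.Nat.Properties using (≤-refl; m≤n⇒m≤1+n; 1+n≰n)
open import Data.Product.Base using (_,_)
open import Data.Sum.Base using (_⊎_; inj₁; inj₂)
open import Data.Vec.Base using (Vec; []; _∷_)
import Data.Vec.Properties as Vec
open import Function.Base using (_∘_; id)
open import Relation.Binary.PropositionalEquality as ≡
  using (_≡_; _≢_; _≗_; refl; sym; trans; cong; cong₂)

-- Substitution

module _ {L : Signature} where

  ↑_ : ∀ {n} → Term L n → Term L (suc n)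
  ↑_ = substTerm (var ∘ suc)

  substTerm-cong : ∀ {m n} {σ τ : Fin m → Term L n} → σ ≗ τ →
                   substTerm σ ≗ substTerm τ
  substTerm-cong σ≗τ (var i)   = σ≗τ i
  substTerm-cong σ≗τ (const c) = refl

  lift-cong : ∀ {m n} {σ τ : Fin m → Term L n} → σ ≗ τ → lift σ ≗ lift τ
  lift-cong σ≗τ zero    = refl
  lift-cong σ≗τ (suc i) = cong ↑_ (σ≗τ i)

  subst-cong : ∀ {m n} {σ τ : Fin m → Term L n} → σ ≗ τ → subst σ ≗ subst τ
  subst-cong σ≗τ (rel R ts) = cong (rel R) (Vec.map-cong (substTerm-cong σ≗τ) ts)
  subst-cong σ≗τ (s ≐ t)    = cong₂ _≐_ (substTerm-cong σ≗τ s) (substTerm-cong σ≗τ t)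
  subst-cong σ≗τ ⊥̇          = refl
  subst-cong σ≗τ (φ ∧̇ ψ)    = cong₂ _∧̇_ (subst-cong σ≗τ φ) (subst-cong σ≗τ ψ)
  subst-cong σ≗τ (φ ∨̇ ψ)    = cong₂ _∨̇_ (subst-cong σ≗τ φ) (subst-cong σ≗τ ψ)
  subst-cong σ≗τ (φ ⇒̇ ψ)    = cong₂ _⇒̇_ (subst-cong σ≗τ φ) (subst-cong σ≗τ ψ)
  subst-cong σ≗τ (∀̇ φ)      = cong ∀̇ (subst-cong (lift-cong σ≗τ) φ)
  subst-cong σ≗τ (∃̇ φ)      = cong ∃̇ (subst-cong (lift-cong σ≗τ) φ)

  substTerm-var : ∀ {n} → substTerm {L} {n} var ≗ id
  substTerm-var (var i)   = refl
  substTerm-var (const c) = refl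

  lift-var : ∀ {n} → lift {L} {n} var ≗ var
  lift-var zero    = refl
  lift-var (suc i) = refl

  subst-var : ∀ {n} → subst {L} {n} var ≗ id
  subst-var (rel R ts) =
    cong (rel R) (trans (Vec.map-cong substTerm-var ts) (Vec.map-id ts))
  subst-var (s ≐ t)    = cong₂ _≐_ (substTerm-var s) (substTerm-var t)
  subst-var ⊥̇          = refl
  subst-var (φ ∧̇ ψ)    = cong₂ _∧̇_ (subst-var φ) (subst-var ψ)
  subst-var (φ ∨̇ ψ)    = cong₂ _∨̇_ (subst-var φ) (subst-var ψ)
  subst-var (φ ⇒̇ ψ)    = cong₂ _⇒̇_ (subst-var φ) (subst-var ψ)
  subst-var (∀̇ φ)      = cong ∀̇ (trans (subst-cong lift-var φ) (subst-var φ))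
  subst-var (∃̇ φ)      = cong ∃̇ (trans (subst-cong lift-var φ) (subst-var φ))

  substTerm-∘ : ∀ {l m n} (σ : Fin m → Term L n) (τ : Fin l → Term L m) →
                substTerm σ ∘ substTerm τ ≗ substTerm (substTerm σ ∘ τ)
  substTerm-∘ σ τ (var i)   = refl
  substTerm-∘ σ τ (const c) = refl

  lift-∘ : ∀ {l m n} (σ : Fin m → Term L n) (τ : Fin l → Term L m) →
           substTerm (lift σ) ∘ lift τ ≗ lift (substTerm σ ∘ τ)
  lift-∘ σ τ zero    = refl
  lift-∘ σ τ (suc i) = trans (substTerm-∘ (lift σ) (var ∘ suc) (τ i))
                             (sym (substTerm-∘ (var ∘ suc) σ (τ i)))

  subst-∘ : ∀ {l m n} (σ : Fin m → Term L n) (τ : Fin l → Term L m) →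
            subst σ ∘ subst τ ≗ subst (substTerm σ ∘ τ)
  subst-∘ σ τ (rel R ts) = cong (rel R)
    (trans (sym (Vec.map-∘ _ _ ts)) (Vec.map-cong (substTerm-∘ σ τ) ts))
  subst-∘ σ τ (s ≐ t)    = cong₂ _≐_ (substTerm-∘ σ τ s) (substTerm-∘ σ τ t)
  subst-∘ σ τ ⊥̇          = refl
  subst-∘ σ τ (φ ∧̇ ψ)    = cong₂ _∧̇_ (subst-∘ σ τ φ) (subst-∘ σ τ ψ)
  subst-∘ σ τ (φ ∨̇ ψ)    = cong₂ _∨̇_ (subst-∘ σ τ φ) (subst-∘ σ τ ψ)
  subst-∘ σ τ (φ ⇒̇ ψ)    = cong₂ _⇒̇_ (subst-∘ σ τ φ) (subst-∘ σ τ ψ)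
  subst-∘ σ τ (∀̇ φ)      = cong ∀̇
    (trans (subst-∘ (lift σ) (lift τ) φ) (subst-cong (lift-∘ σ τ) φ))
  subst-∘ σ τ (∃̇ φ)      = cong ∃̇
    (trans (subst-∘ (lift σ) (lift τ) φ) (subst-cong (lift-∘ σ τ) φ))

  -- Weakening leaves the bound variable alone, so instantiating with that variable undoes it. This
  -- reopens a quantified formula that `∀-I` or `∃-E` has moved under a fresh variable.
  lift-weaken-var : ∀ {n} (φ : Formula L (suc n)) →
                    subst (lift (var ∘ suc)) φ [ var zero /0] ≡ φ
  lift-weaken-var φ =
    trans (subst-∘ _ _ φ)
          (trans (subst-cong (λ { zero → refl ; (suc i) → refl }) φ) (subst-var φ))

  -- Both sides apply one and the same substitution. The right side is the shape that `∃-E` demands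
  -- of its conclusion.
  lift-weaken-↑ : ∀ {n} (φ : Formula L (suc n)) (t : Term L n) →
                  subst (lift (var ∘ suc)) φ [ ↑ t /0] ≡ weaken (φ [ t /0])
  lift-weaken-↑ φ t =
    trans (subst-∘ _ _ φ)
          (trans (subst-cong (λ { zero → refl ; (suc i) → refl }) φ)
                 (sym (subst-∘ _ _ φ)))

  subst-⋁ : ∀ {A : Set} {m n} (σ : Fin m → Term L n) (φ : A → Formula L m) xs →
            subst σ (⋁̇ (map φ xs)) ≡ ⋁̇ (map (subst σ ∘ φ) xs)
  subst-⋁ σ φ []       = refl
  subst-⋁ σ φ (x ∷ xs) = cong (_ ∨̇_) (subst-⋁ σ φ xs)

-- Derived rules

module _ {L : Signature} {T : Theory L} {n : ℕ} where

  module _ {Γ : List (Formula L n)} where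

    h0 : ∀ {φ} → T ⨾ φ ∷ Γ ⊢ φ
    h0 = hyp (here refl)

    h1 : ∀ {φ ψ} → T ⨾ ψ ∷ φ ∷ Γ ⊢ φ
    h1 = hyp (there (here refl))

    h2 : ∀ {φ ψ χ} → T ⨾ χ ∷ ψ ∷ φ ∷ Γ ⊢ φ
    h2 = hyp (there (there (here refl)))

    cut : ∀ {φ ψ} → T ⨾ Γ ⊢ φ → T ⨾ φ ∷ Γ ⊢ ψ → T ⨾ Γ ⊢ ψ
    cut d e = ⇒-E (⇒-I e) d

  module _ {Γ : List (Formula L n)} where

    coerce : ∀ {φ ψ} → φ ≡ ψ → T ⨾ Γ ⊢ φ → T ⨾ Γ ⊢ ψ
    coerce refl d = d

    ⊥-E : ∀ {φ} → T ⨾ Γ ⊢ ⊥̇ → T ⨾ Γ ⊢ φ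
    ⊥-E d = cut d (raa h1)

    excluded-middle : ∀ φ → T ⨾ Γ ⊢ φ ∨̇ ¬̇ φ
    excluded-middle φ =
      raa (⇒-E h0 (∨-I₂ (⇒-I (⇒-E h1 (∨-I₁ h0)))))

    ⇔-refl : ∀ {φ} → T ⨾ Γ ⊢ φ ⇔̇ φ
    ⇔-refl = ∧-I (⇒-I h0) (⇒-I h0)

    ⇔-sym : ∀ {φ ψ} → T ⨾ Γ ⊢ φ ⇔̇ ψ → T ⨾ Γ ⊢ ψ ⇔̇ φ
    ⇔-sym d = ∧-I (∧-E₂ d) (∧-E₁ d)

    ⇒-trans : ∀ {φ ψ χ} → T ⨾ Γ ⊢ φ ⇒̇ ψ → T ⨾ Γ ⊢ ψ ⇒̇ χ → T ⨾ Γ ⊢ φ ⇒̇ χ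
    ⇒-trans d e = ⇒-E (⇒-E (⇒-I (⇒-I (⇒-I (⇒-E h1 (⇒-E h2 h0))))) d) e

    ⇔-trans : ∀ {φ ψ χ} → T ⨾ Γ ⊢ φ ⇔̇ ψ → T ⨾ Γ ⊢ ψ ⇔̇ χ → T ⨾ Γ ⊢ φ ⇔̇ χ
    ⇔-trans d e = ∧-I (⇒-trans (∧-E₁ d) (∧-E₁ e)) (⇒-trans (∧-E₂ e) (∧-E₂ d))

    ≐-sym : ∀ {s t} → T ⨾ Γ ⊢ s ≐ t → T ⨾ Γ ⊢ t ≐ s
    ≐-sym {s} {t} d =
      coerce (cong (t ≐_) (↑-single s t))
        (≐-E (var zero ≐ ↑ s) d
          (coerce (cong (s ≐_) (sym (↑-single s s))) ≐-I))
      where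
      ↑-single : ∀ s t → substTerm (single t) (↑ s) ≡ s
      ↑-single (var i)   t = refl
      ↑-single (const c) t = refl

  module _ {Γ : List (Formula L n)} where

    ⋁-I : ∀ {A : Set} (φ : A → Formula L n) {x xs} →
          x ∈ xs → T ⨾ Γ ⊢ φ x → T ⨾ Γ ⊢ ⋁̇ (map φ xs)
    ⋁-I φ (here refl) d = ∨-I₁ d
    ⋁-I φ (there x∈)  d = ∨-I₂ (⋁-I φ x∈ d)

  -- Each nested `∨-E` adds a hypothesis, so the branches are asked for over every context `Δ`; no
  -- weakening of derivations is then involved.
  ⋁-E : ∀ {A : Set} (φ : A → Formula L n) {χ Γ} xs →
        (∀ {x Δ} → x ∈ xs → T ⨾ φ x ∷ Δ ⊢ χ) →
        T ⨾ Γ ⊢ ⋁̇ (map φ xs) → T ⨾ Γ ⊢ χ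
  ⋁-E φ []       f d = ⊥-E d
  ⋁-E φ (x ∷ xs) f d = ∨-E d (f (here refl)) (⋁-E φ xs (f ∘ there) h0)

-- Translations with trivial domain that interpret constants by constants

module Direct {L M : Signature} (κ : Const L → Const M)
              (ρ : (R : Rel L) → Formula M (arity L R)) (S : Theory M) where

  direct : Translation L M
  direct = record
    { domain = var zero ≐ var zero
    ; constF = λ c → var zero ≐ const (κ c)
    ; relF   = ρ
    }

  open Translation direct using (domain; constF)

  ⟦_⟧ₜ : ∀ {n} → Term L n → Term M n
  ⟦ var i ⟧ₜ   = var i
  ⟦ const c ⟧ₜ = const (κ c)

  instantiate : ∀ {k n} → Vec (Term L n) k → Formula M (k + n) → Formula M n
  instantiate                []       φ = φ
  instantiate {suc k} (t ∷ ts) φ =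
    instantiate ts (φ [ ⟦ substTerm (var ∘ (k ↑ʳ_)) t ⟧ₜ /0])

  -- A simplified translation, without relativisation and with constants substituted directly. On
  -- concrete formulas it computes to readable ones, unlike `translate`.
  ⟦_⟧ : ∀ {n} → Formula L n → Formula M n
  ⟦_⟧ {n} (rel R ts) = instantiate ts (rename (_↑ˡ n) (ρ R))
  ⟦ s ≐ t ⟧          = instantiate (s ∷ t ∷ []) (var zero ≐ var (suc zero))
  ⟦ ⊥̇ ⟧              = ⊥̇
  ⟦ φ ∧̇ ψ ⟧          = ⟦ φ ⟧ ∧̇ ⟦ ψ ⟧
  ⟦ φ ∨̇ ψ ⟧          = ⟦ φ ⟧ ∨̇ ⟦ ψ ⟧
  ⟦ φ ⇒̇ ψ ⟧          = ⟦ φ ⟧ ⇒̇ ⟦ ψ ⟧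
  ⟦ ∀̇ φ ⟧            = ∀̇ ⟦ φ ⟧
  ⟦ ∃̇ φ ⟧            = ∃̇ ⟦ φ ⟧

  infix 2 _≈_

  -- Equivalence in every context, so that it can be used under binders and added hypotheses.
  _≈_ : ∀ {n} → Formula M n → Formula M n → Set
  φ ≈ ψ = ∀ {Γ} → S ⨾ Γ ⊢ φ ⇔̇ ψ

  to : ∀ {n} {φ ψ : Formula M n} {Γ} → φ ≈ ψ → S ⨾ Γ ⊢ φ → S ⨾ Γ ⊢ ψ
  to e d = ⇒-E (∧-E₁ e) d

  from : ∀ {n} {φ ψ : Formula M n} {Γ} → φ ≈ ψ → S ⨾ Γ ⊢ ψ → S ⨾ Γ ⊢ φ
  from e d = ⇒-E (∧-E₂ e) d

  ∀-E-lifted : ∀ {n Γ} {φ : Formula M (suc n)} →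
               S ⨾ Γ ⊢ weaken (∀̇ φ) → S ⨾ Γ ⊢ φ
  ∀-E-lifted {φ = φ} d =
    coerce (lift-weaken-var φ) (∀-E d (var zero))

  ∃-I-lifted : ∀ {n Γ} {φ : Formula M (suc n)} →
               S ⨾ Γ ⊢ φ → S ⨾ Γ ⊢ weaken (∃̇ φ)
  ∃-I-lifted {φ = φ} d =
    ∃-I (var zero) (coerce (sym (lift-weaken-var φ)) d)

  module _ {n} {φ ψ : Formula M (suc n)} (e : φ ≈ ψ) where

    -- Variable 0 is generalised and then instantiated, so no induction on formulas is required.
    subst₀-≈ : ∀ t → φ [ t /0] ≈ ψ [ t /0]
    subst₀-≈ t = ∀-E (∀-I e) t

    ∀-≈ : ∀̇ (at0 direct domain ⇒̇ φ) ≈ ∀̇ ψ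
    ∀-≈ = ∧-I
      (⇒-I (∀-I (to e (⇒-E (∀-E-lifted {φ = at0 direct domain ⇒̇ φ} h0) ≐-I))))
      (⇒-I (∀-I (⇒-I (from e (∀-E-lifted h1)))))

    ∃-≈ : ∃̇ (at0 direct domain ∧̇ φ) ≈ ∃̇ ψ
    ∃-≈ = ∧-I
      (⇒-I (∃-E h0 (∃-I-lifted (to e (∧-E₂ h0)))))
      (⇒-I (∃-E h0 (∃-I-lifted {φ = at0 direct domain ∧̇ φ} (∧-I ≐-I (from e h0)))))

  instantiate-≈ : ∀ {k n} (ts : Vec (Term L n) k) {φ ψ} →
                  φ ≈ ψ → instantiate ts φ ≈ instantiate ts ψ
  instantiate-≈ []       e = e
  instantiate-≈ (t ∷ ts) e = instantiate-≈ ts (subst₀-≈ e _)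

  atValue-≈ : ∀ {n} (t : Term L n) φ → atValue direct t φ ≈ φ [ ⟦ t ⟧ₜ /0]
  atValue-≈ (var i)   φ = ⇔-refl
  atValue-≈ (const c) φ = ∧-I
    (⇒-I (∃-E h0
      -- The witness equals `const (κ c)`; rewriting with this equation removes the witness from the
      -- conclusion.
      (coerce (lift-weaken-↑ φ (const (κ c)))
        (≐-E (subst (lift (var ∘ suc)) φ) (∧-E₁ (∧-E₂ h0))
          (coerce (sym (lift-weaken-var φ)) (∧-E₂ (∧-E₂ h0)))))))
    (⇒-I (∃-I (const (κ c)) (∧-I ≐-I (∧-I ≐-I h0))))

  atValues-≈ : ∀ {k n} (ts : Vec (Term L n) k) φ →
               atValues direct ts φ ≈ instantiate ts φ
  atValues-≈ []       φ = ⇔-refl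
  atValues-≈ (t ∷ ts) φ =
    ⇔-trans (atValues-≈ ts _) (instantiate-≈ ts (atValue-≈ _ φ))

  translate-≈ : ∀ {n} (φ : Formula L n) → translate direct φ ≈ ⟦ φ ⟧
  translate-≈ (rel R ts) = atValues-≈ ts _
  translate-≈ (s ≐ t)    = atValues-≈ (s ∷ t ∷ []) _
  translate-≈ ⊥̇          = ⇔-refl
  translate-≈ (φ ∧̇ ψ)    = ∧-I
    (⇒-I (∧-I (to (translate-≈ φ) (∧-E₁ h0)) (to (translate-≈ ψ) (∧-E₂ h0))))
    (⇒-I (∧-I (from (translate-≈ φ) (∧-E₁ h0)) (from (translate-≈ ψ) (∧-E₂ h0))))
  translate-≈ (φ ∨̇ ψ)    = ∧-I
    (⇒-I (∨-E h0 (∨-I₁ (to (translate-≈ φ) h0)) (∨-I₂ (to (translate-≈ ψ) h0))))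
    (⇒-I (∨-E h0 (∨-I₁ (from (translate-≈ φ) h0)) (∨-I₂ (from (translate-≈ ψ) h0))))
  translate-≈ (φ ⇒̇ ψ)    = ∧-I
    (⇒-I (⇒-I (to (translate-≈ ψ) (⇒-E h1 (from (translate-≈ φ) h0)))))
    (⇒-I (⇒-I (from (translate-≈ ψ) (⇒-E h1 (to (translate-≈ φ) h0)))))
  translate-≈ (∀̇ φ)      = ∀-≈ (translate-≈ φ)
  translate-≈ (∃̇ φ)      = ∃-≈ (translate-≈ φ)

  direct-interpretation : ∀ {T : Theory L} → (∀ {φ} → T φ → S ⊢ ⟦ φ ⟧) →
                          IsInterpretation T S direct
  direct-interpretation ax = record
    { domain-nonempty = inhabited
    ; const-defined   = λ c → ∃-I (const (κ c))
        (∧-I (∧-I ≐-I ≐-I) (∀-I (⇒-I (∧-E₂ h0))))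
    ; axioms          = λ {φ} a → from (translate-≈ φ) (ax a)
    }

-- Segments of strings

open Rel₀ using (Symbol; init; end)

dual : Symbol → Symbol
dual init = end
dual end  = init

segments : Symbol → Σ* → List Σ*
segments init = inits
segments end  = tails

-- The letter is added on the side where the `R`-segments of `s` remain `R`-segments. The `Symbol`
-- argument lets one proof serve both orders.
extend : Symbol → Σ* → D → Σ*
extend init s d = s ∷ʳ d
extend end  s d = d ∷ s

-- `inits` recurses from the front while `extend init` adds at the back; for `tails` and
-- `extend end` the analogue holds by computation.
inits-∷ʳ : ∀ {A : Set} (s : List A) d → inits (s ∷ʳ d) ≡ inits s ∷ʳ (s ∷ʳ d)
inits-∷ʳ []      d = refl
inits-∷ʳ (x ∷ s) d =
  cong ([] ∷_) (trans (cong (map (x ∷_)) (inits-∷ʳ s d)) (map-++ (x ∷_) (inits s) _))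

segments-extend⁻ : ∀ R s d {u} → u ∈ segments R (extend R s d) →
                   u ∈ segments R s ⊎ u ≡ extend R s d
segments-extend⁻ init s d {u} u∈
  with ∈-++⁻ (inits s) (≡.subst (u ∈_) (inits-∷ʳ s d) u∈)
... | inj₁ u∈′      = inj₁ u∈′
... | inj₂ (here p) = inj₂ p
segments-extend⁻ end s d (here p)   = inj₂ p
segments-extend⁻ end s d (there u∈) = inj₁ u∈

segments-extend⁺ : ∀ R s d {u} → u ∈ segments R s → u ∈ segments R (extend R s d)
segments-extend⁺ init s d {u} u∈ =
  ≡.subst (u ∈_) (sym (inits-∷ʳ s d)) (∈-++⁺ˡ u∈)
segments-extend⁺ end s d u∈ = there u∈

extend∈segments : ∀ R s d → extend R s d ∈ segments R (extend R s d)
extend∈segments init s d =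
  ≡.subst ((s ∷ʳ d) ∈_) (sym (inits-∷ʳ s d)) (∈-++⁺ʳ (inits s) (here refl))
extend∈segments end s d = here refl

[]∈segments : ∀ R s → [] ∈ segments R s
[]∈segments init s       = here refl
[]∈segments end  []      = here refl
[]∈segments end  (x ∷ s) = there ([]∈segments end s)

segments-[] : ∀ R {u} → u ∈ segments R [] → u ≡ []
segments-[] init (here p) = p
segments-[] end  (here p) = p

-- The letter added on one side is visible as a segment from the other; this is the letter test in
-- `Candidate`.
[d]∈segments-dual : ∀ R s d → [ d ] ∈ segments (dual R) (extend R s d)
[d]∈segments-dual init []      d = here refl
[d]∈segments-dual init (x ∷ s) d = there ([d]∈segments-dual init s d)
[d]∈segments-dual end  s       d = there (here refl)

segments-length : ∀ R s {u} → u ∈ segments R s → length u ≤ length s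
segments-length init s       (here refl) = z≤n
segments-length init (x ∷ s) (there u∈) with ∈-map⁻ (x ∷_) u∈
... | v , v∈ , refl = s≤s (segments-length init s v∈)
segments-length end  s       (here refl) = ≤-refl
segments-length end  (x ∷ s) (there u∈)  = m≤n⇒m≤1+n (segments-length end s u∈)

length-extend : ∀ R s d → length (extend R s d) ≡ suc (length s)
length-extend init s d =
  trans (length-++-sucʳ s d []) (cong (suc ∘ length) (++-identityʳ s))
length-extend end  s d = refl

-- By length: a segment of `s` is at most as long as `s`, and the extension is longer by one.
extend∉segments : ∀ R s d → extend R s d ∉ segments R s
extend∉segments R s d e∈ =
  1+n≰n (≡.subst (_≤ length s) (length-extend R s d) (segments-length R s e∈))

-- The successor relations in VW₀

L₀ : Signature
L₀ = Rel₀.signature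

seg strict : Symbol → ∀ {n} → Term L₀ n → Term L₀ n → Formula L₀ n
seg R x y    = rel R (x ∷ y ∷ [])
strict R x y = seg R x y ∧̇ ¬̇ (x ≐ y)

module _ (R : Symbol) (d : D) where

  -- The axioms `⊏-determines` and `⊐-determines` concern constants only, so for arbitrary `x`
  -- uniqueness has to be written into `Successor`.
  Candidate Successor Graph : ∀ {n} → Term L₀ n → Term L₀ n → Formula L₀ n
  Candidate x y =
    ∀̇ (strict R v0 (↑ y) ⇔̇ seg R v0 (↑ x)) ∧̇ seg (dual R) (const [ d ]) y
  Successor x y = Candidate x y ∧̇ ∀̇ (Candidate (↑ x) v0 ⇒̇ v0 ≐ ↑ y)
  Graph x y     = Successor x y ∨̇ ¬̇ ∃̇ (Successor (↑ x) v0) ∧̇ y ≐ x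

  module _ {T : Theory L₀} {n} {Γ : List (Formula L₀ n)} where

    Graph-total : T ⨾ Γ ⊢ ∀̇ (∃̇ (Graph v1 v0))
    Graph-total = ∀-I (∨-E (excluded-middle (∃̇ (Successor v1 v0)))
      (∃-E h0 (∃-I v0 (∨-I₁ h0)))
      -- Without a successor the default value is the argument itself.
      (∃-I v0 (∨-I₂ (∧-I h0 ≐-I))))

    -- Two successors agree by the uniqueness clause of one of them, a successor excludes the
    -- default case, and two default values both equal the argument.
    Graph-functional :
      T ⨾ Γ ⊢ ∀̇ (∀̇ (∀̇ (Graph v2 v1 ∧̇ Graph v2 v0 ⇒̇ v1 ≐ v0)))
    Graph-functional = ∀-I (∀-I (∀-I (⇒-I (∨-E (∧-E₁ h0)
      (∨-E (∧-E₂ h1)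
        (⇒-E (∀-E (∧-E₂ h0) v1) (∧-E₁ h1))
        (⊥-E (⇒-E (∧-E₁ h0) (∃-I v1 h1))))
      (∨-E (∧-E₂ h1)
        (⊥-E (⇒-E (∧-E₁ h1) (∃-I v0 h0)))
        -- In the rewritten formula `v0` is the hole, so `v2` there is the outer `v1`.
        (≐-E (v2 ≐ v0) (≐-sym (∧-E₂ h0)) (∧-E₂ h1)))))))

-- Consequences of VW₀

distinct : ∀ {n s t} {Γ : List (Formula L₀ n)} → s ≢ t →
           VW₀ ⨾ Γ ⊢ ¬̇ (const s ≐ const t)
distinct s≢t = axiom (Rel₀.distinct s≢t)

seg-const : ∀ R t {n} {Γ : List (Formula L₀ n)} x →
            VW₀ ⨾ Γ ⊢ seg R x (const t) ⇔̇
                      ⋁̇ (map (λ s → x ≐ const s) (segments R t))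
seg-const R t {Γ = Γ} x = instance-of R
  where
  -- The disjunction is as long as the list of segments of `t`, so the substitutions made by `axiom`
  -- and `∀-E` do not compute through it and are pushed in by `subst-⋁`.
  unfold : ∀ (σ : Fin 0 → Term L₀ _) ss →
           subst (single x) (subst (lift σ) (⋁̇ (map (λ s → v0 ≐ const s) ss)))
           ≡ ⋁̇ (map (λ s → x ≐ const s) ss)
  unfold σ ss = trans (cong (subst (single x)) (subst-⋁ (lift σ) _ ss))
                      (subst-⋁ (single x) _ ss)

  instance-of : ∀ R → VW₀ ⨾ Γ ⊢ seg R x (const t) ⇔̇
                                ⋁̇ (map (λ s → x ≐ const s) (segments R t))
  instance-of init = coerce (cong (seg init x (const t) ⇔̇_) (unfold _ (inits t)))
                            (∀-E (axiom (Rel₀.⊑-const t)) x)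
  instance-of end  = coerce (cong (seg end x (const t) ⇔̇_) (unfold _ (tails t)))
                            (∀-E (axiom (Rel₀.⊒-const t)) x)

⋀D-E : ∀ {T : Theory L₀} {n} {Γ : List (Formula L₀ n)} φ d →
       T ⨾ Γ ⊢ ⋀D φ → T ⨾ Γ ⊢ φ d
⋀D-E φ 𝟏 = ∧-E₁
⋀D-E φ 𝟐 = ∧-E₂

-- A common form of the two axioms, with the conjunction over letters resolved at `d`.
strict-determines : ∀ R d t {n} {Γ : List (Formula L₀ n)} →
  VW₀ ⨾ Γ ⊢ ∀̇ (∀̇ (strict R v0 v1 ⇔̇ strict R v0 (const t)) ⇒̇
                seg (dual R) (const [ d ]) v0 ∧̇
                seg (dual R) (const [ d ]) (const t) ⇒̇ v0 ≐ const t)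
strict-determines init d t =
  ∀-I (⇒-I (⋀D-E (λ d → seg end (const [ d ]) v0 ∧̇ seg end (const [ d ]) (const t)
                        ⇒̇ v0 ≐ const t) d
    (⇒-E (∀-E (axiom (Rel₀.⊏-determines t)) v0) h0)))
strict-determines end d t =
  ∀-I (⇒-I (⋀D-E (λ d → seg init (const [ d ]) v0 ∧̇ seg init (const [ d ]) (const t)
                        ⇒̇ v0 ≐ const t) d
    (⇒-E (∀-E (axiom (Rel₀.⊐-determines t)) v0) h0)))

module _ (R : Symbol) {n} {Γ : List (Formula L₀ n)} where

  seg-const-≐-I : ∀ {x s t} → s ∈ segments R t →
                  VW₀ ⨾ Γ ⊢ x ≐ const s → VW₀ ⨾ Γ ⊢ seg R x (const t)
  seg-const-≐-I {x} {t = t} s∈ d = ⇒-E (∧-E₂ (seg-const R t x))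
                                       (⋁-I (λ u → x ≐ const u) s∈ d)

  seg-const-I : ∀ {s t} → s ∈ segments R t → VW₀ ⨾ Γ ⊢ seg R (const s) (const t)
  seg-const-I s∈ = seg-const-≐-I s∈ ≐-I

  -- Below a constant lie only finitely many elements, all constants, so a proof may go through them
  -- case by case.
  seg-const-E : ∀ {x t χ} →
                (∀ {s Δ} → s ∈ segments R t → VW₀ ⨾ x ≐ const s ∷ Δ ⊢ χ) →
                VW₀ ⨾ Γ ⊢ seg R x (const t) → VW₀ ⨾ Γ ⊢ χ
  seg-const-E {x} {t} f d =
    ⋁-E (λ u → x ≐ const u) (segments R t) f (⇒-E (∧-E₁ (seg-const R t x)) d)

-- Segments and successors of constants

module _ (R : Symbol) where

  []-least : ∀ {n} {Γ : List (Formula L₀ n)} →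
             VW₀ ⨾ Γ ⊢ ∀̇ (seg R v0 (const []) ⇒̇ v0 ≐ const [])
  []-least = ∀-I (⇒-I (seg-const-E R (λ s∈ → ≡-const (segments-[] R s∈)) h0))
    where
    ≡-const : ∀ {n x s t} {Γ : List (Formula L₀ n)} → s ≡ t →
              VW₀ ⨾ x ≐ const s ∷ Γ ⊢ x ≐ const t
    ≡-const refl = h0

  module _ (t : Σ*) (d : D) where

    td : Σ*
    td = extend R t d

    -- Lengthening a string by one letter adds exactly one entry, the new string, to its finite list
    -- of segments.
    seg-extend : ∀ {n} {Γ : List (Formula L₀ n)} x →
      VW₀ ⨾ Γ ⊢ seg R x (const td) ⇔̇ seg R x (const t) ∨̇ x ≐ const td
    seg-extend x = ∧-I
      (⇒-I (seg-const-E R (λ s∈ → split (segments-extend⁻ R t d s∈)) h0))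
      (⇒-I (∨-E h0
        (seg-const-E R (λ s∈ → seg-const-≐-I R (segments-extend⁺ R t d s∈) h0) h0)
        (seg-const-≐-I R (extend∈segments R t d) h0)))
      where
      split : ∀ {s Δ} → s ∈ segments R t ⊎ s ≡ td →
              VW₀ ⨾ x ≐ const s ∷ Δ ⊢ seg R x (const t) ∨̇ x ≐ const td
      split (inj₁ s∈)   = ∨-I₁ (seg-const-≐-I R s∈ h0)
      split (inj₂ refl) = ∨-I₂ h0

    strict-extend : ∀ {n} {Γ : List (Formula L₀ n)} →
      VW₀ ⨾ Γ ⊢ ∀̇ (strict R v0 (const td) ⇔̇ seg R v0 (const t))
    strict-extend = ∀-I (∧-I
      (⇒-I (∨-E (⇒-E (∧-E₁ (seg-extend v0)) (∧-E₁ h0))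
        h0
        (⊥-E (⇒-E (∧-E₂ h1) h0))))
      (⇒-I (∧-I
        (⇒-E (∧-E₂ (seg-extend v0)) (∨-I₁ h0))
        (seg-const-E R proper h0))))
      where
      proper : ∀ {n s} {Δ : List (Formula L₀ (suc n))} → s ∈ segments R t →
               VW₀ ⨾ v0 ≐ const s ∷ Δ ⊢ ¬̇ (v0 ≐ const td)
      -- An element equal to both `s` and `td` would identify two distinct constants.
      proper s∈ = ⇒-I (⇒-E
        (distinct (λ { refl → extend∉segments R t d s∈ }))
        (≐-E (v0 ≐ const td) h1 h0))

    Candidate-const : ∀ {n} {Γ : List (Formula L₀ n)} →
                      VW₀ ⨾ Γ ⊢ Candidate R d (const t) (const td)
    Candidate-const =
      ∧-I strict-extend (seg-const-I (dual R) ([d]∈segments-dual R t d))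

    Candidate-const-unique : ∀ {n} {Γ : List (Formula L₀ n)} →
      VW₀ ⨾ Γ ⊢ ∀̇ (Candidate R d (const t) v0 ⇒̇ v0 ≐ const td)
    Candidate-const-unique = ∀-I (⇒-I (⇒-E
      (⇒-E (∀-E (strict-determines R d td) v0)
        -- A candidate and `td` have the same proper segments, since both sets are the segments of
        -- `t`.
        (∀-I (⇔-trans (∀-E (∧-E₁ h0) v0) (⇔-sym (∀-E strict-extend v0)))))
      (∧-I (∧-E₂ h0) (∧-E₂ Candidate-const))))

    Graph-const : ∀ {n} {Γ : List (Formula L₀ n)} →
                  VW₀ ⨾ Γ ⊢ Graph R d (const t) (const td)
    Graph-const = ∨-I₁ (∧-I Candidate-const Candidate-const-unique)

    -- By functionality the value at `t` is `td`, for which the claim is `seg-extend`.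
    Graph-seg : ∀ {n} {Γ : List (Formula L₀ n)} →
      VW₀ ⨾ Γ ⊢ ∀̇ (Graph R d (const t) v0 ⇒̇
                    ∀̇ (seg R v0 v1 ⇔̇ seg R v0 (const t) ∨̇ v0 ≐ v1))
    Graph-seg = ∀-I (⇒-I
      (≐-E (∀̇ (seg R v0 v1 ⇔̇ seg R v0 (const t) ∨̇ v0 ≐ v1))
        (⇒-E (∀-E (∀-E (∀-E (Graph-functional R d) (const t)) (const td)) v0)
             (∧-I Graph-const h0))
        (∀-I (seg-extend v0))))

-- The interpretation

relation : (R : Rel*.Symbol) → Formula L₀ 2
relation (Rel*.A^ d) = Graph init d v0 v1
relation (Rel*.Aᵛ d) = Graph end d v0 v1
relation Rel*.init   = seg init v0 v1
relation Rel*.end    = seg end v0 v1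

open Direct {L = Rel*.signature} id relation VW₀
  using (⟦_⟧; direct; direct-interpretation)

-- Translation and substitution compute on each axiom, so every case is literally a fact proved
-- above or an axiom of `VW₀`.
axiom-provable : ∀ {φ} → VW*Rel φ → VW₀ ⊢ ⟦ φ ⟧
axiom-provable (Rel*.distinct s≢t) = distinct s≢t
axiom-provable (Rel*.A^-const d s) = Graph-const init s d
axiom-provable (Rel*.Aᵛ-const d s) = Graph-const end s d
axiom-provable (Rel*.A^-⊑ d t)     = Graph-seg init t d
axiom-provable (Rel*.Aᵛ-⊒ d t)     = Graph-seg end t d
axiom-provable (Rel*.A^-total d)   = Graph-total init d
axiom-provable (Rel*.Aᵛ-total d)   = Graph-total end d
axiom-provable (Rel*.A^-func d)    = Graph-functional init d
axiom-provable (Rel*.Aᵛ-func d)    = Graph-functional end d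
axiom-provable (Rel*.e-⊑ t)        = seg-const-I init ([]∈segments init t)
axiom-provable Rel*.⊑-e            = []-least init
axiom-provable (Rel*.e-⊒ t)        = seg-const-I end ([]∈segments end t)
axiom-provable Rel*.⊒-e            = []-least end
axiom-provable Rel*.⊑-antisym      = axiom Rel₀.⊑-antisym

theorem7p5 : VW*Rel ≤I VW₀
theorem7p5 = direct , direct-interpretation axiom-provable
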